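{- Let $H=\varprojlim\langle\{H_n\},\{h^n_k\}_{k<n}\rangle$ be a profinite poset and $\mathbb{P}=\varprojlim\langle\{P_n\},\{p^n_k\}_{k<n}\rangle$ where $\langle\{P_n\},\{p^n_k\}\rangle$ is a Fraïssé sequence in the category of finite posets with quotient maps, and let $f:\mathbb{P}\to H$ be a continuous quotient map. Then there is a continuous, join-preserving quotient map $q:\mathbb{O}(\mathbb{P})\to\mathbb{O}(H)$ such that $q\circ\phi=\psi\circ f$, where $\phi:\mathbb{P}\to\mathbb{O}(\mathbb{P})$ and $\psi:H\to\mathbb{O}(H)$ are given by $(x_n)\mapsto(\downarrow x_n)$.
   Context: A quotient map between posets is a surjective order-preserving map $\phi:A\to B$ such that for all $a\le b$ in $B$ there are $x\le y$ in $A$ with $\phi(x)=a,\phi(y)=b$. A profinite poset is an inverse limit $\{(x_n)\in\prod_nP_n:p^{n+1}_n(x_{n+1})=x_n\ \forall n\}$ of nonempty finite posets $P_n$ with quotient maps $p^m_k:P_m\to P_k$ ($k<m$, $p^k_l\circ p^m_k=p^m_l$), ordered coordinatewise, with the subspace topology of the product of discrete spaces. Fraïssé sequence: (U) for every finite poset $X$ there are $n$ and a quotient map $P_n\to X$; (A) for every $k$, every finite poset $Y$ and quotient map $f:Y\to P_k$ there exist $\ell>k$ and a quotient map $g:P_\ell\to Y$ with $f\circ g=p^\ell_k$. $\downarrow x=\{m:m\le x\}$; $\mathcal{O}(P_n)$ is the set of down-sets of $P_n$ under inclusion; for a quotient map $p:Q\to R$ of finite posets, $\hat p(\emptyset)=\emptyset$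 and $\hat p(A)=\bigcup_i\downarrow p(a_i)$ over the maximal elements $a_i$ of $A$. For such an inverse system with limit $P$, $\mathbb{O}(P):=\{(A_n)\in\prod_n\mathcal{O}(P_n):\widehat{p^{n+1}_n}(A_{n+1})=A_n\ \forall n\}$, ordered coordinatewise by inclusion and topologized as a subspace of $\prod_n\mathcal{O}(P_n)$ with discrete factors; it is a lattice with join $(A_n)\vee(B_n)=(A_n\cup B_n)$. -}

module Defs where

open import Data.Bool using (true)
open import Data.Fin using (Fin)
open import Data.Fin.Induction using (po-noetherian)
open import Data.Fin.Properties using (all?; any?; _≟_)
open import Data.Fin.Subset using (Subset; _∈_; _⊆_; _∪_)
open import Data.Fin.Subset.Properties
  using (_∈?_; ⊆-antisym; ⊆-refl; ⊆-reflexive; ⊆-trans; p⊆p∪q; q⊆p∪q; x∈p∪q⁺; x∈p∪q⁻)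
open import Data.Nat using (ℕ; suc; _<_; NonZero)
open import Data.Nat.Properties using (<-trans; n<1+n)
open import Data.Product using (Σ; ∃; ∃₂; _×_; _,_; proj₁; proj₂)
open import Data.Sum as Sum using (inj₁; inj₂; [_,_]′)
open import Data.Vec using (tabulate)
open import Data.Vec.Properties using (lookup∘tabulate; []=⇒lookup; lookup⇒[]=)
open import Function using (_∘_)
open import Function.Definitions using (Surjective)
open import Induction.WellFounded using (Acc; acc)
open import Level using (Level; 0ℓ; _⊔_) renaming (suc to lsuc)
open import Relation.Binary.Bundles using (Poset)
open import Relation.Binary.Core using (Rel)
open import Relation.Binary.Lattice.Bundles using (JoinSemilattice)
open import Relation.Binary.Morphism.Structures using (IsOrderHomomorphism)
open import Relation.Binary.PropositionalEquality
  using (_≡_; refl; sym; trans; cong; module ≡-Reasoning)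
open import Relation.Binary.Structures using (IsDecPartialOrder)
open import Relation.Nullary using (Dec; yes; no; does; contradiction)
open import Relation.Nullary.Decidable using (_×-dec_; _→-dec_; dec-true)
open import Relation.Unary using (Pred; Decidable; _≐_; _⊢_)

private variable
  a ℓ : Level
  n : ℕ

record IsQuotientMap (A B : Poset 0ℓ 0ℓ 0ℓ)
                     (φ : Poset.Carrier A → Poset.Carrier B) : Set where
  private
    module A = Poset A
    module B = Poset B
  field
    isOrderHomomorphism : IsOrderHomomorphism A._≈_ B._≈_ A._≤_ B._≤_ φ
    surjective          : Surjective A._≈_ B._≈_ φ
    liftsOrder          : ∀ {a b} → a B.≤ b →
                          ∃₂ λ x y → x A.≤ y × φ x B.≈ a × φ y B.≈ b

-- The category consists of the nonempty finite posets: no nonempty P n maps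
-- onto the empty poset, so universality would otherwise never hold.
-- Classically, decidability of the order is no restriction.

record FinPoset : Set₁ where
  infix 4 _≤_
  field
    size              : ℕ
    nonEmpty          : NonZero size
    _≤_               : Rel (Fin size) 0ℓ
    isDecPartialOrder : IsDecPartialOrder _≡_ _≤_

  Carrier : Set
  Carrier = Fin size

  open IsDecPartialOrder isDecPartialOrder public
    using (_≤?_; isPartialOrder)
    renaming (refl to ≤-refl; reflexive to ≤-reflexive; trans to ≤-trans; antisym to ≤-antisym)

  poset : Poset 0ℓ 0ℓ 0ℓ
  poset = record { isPartialOrder = isPartialOrder }

IsFinQuotientMap : (Q R : FinPoset) → (FinPoset.Carrier Q → FinPoset.Carrier R) → Set
IsFinQuotientMap Q R = IsQuotientMap (FinPoset.poset Q) (FinPoset.poset R)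

comprehension : {P : Pred (Fin n) 0ℓ} → Decidable P → Subset n
comprehension P? = tabulate (does ∘ P?)

module _ {P : Pred (Fin n) 0ℓ} (P? : Decidable P) where

  ∈-comprehension⁺ : ∀ {x} → P x → x ∈ comprehension P?
  ∈-comprehension⁺ {x} px =
    lookup⇒[]= x _ (trans (lookup∘tabulate _ x) (dec-true (P? x) px))

  ∈-comprehension⁻ : ∀ {x} → x ∈ comprehension P? → P x
  ∈-comprehension⁻ {x} x∈ = witness (P? x)
    (trans (sym (lookup∘tabulate (does ∘ P?) x)) ([]=⇒lookup x∈))
    where
    witness : ∀ {A : Set} (A? : Dec A) → does A? ≡ true → A
    witness (yes p) _ = p

module _ (Q : FinPoset) where
  open FinPoset Q

  IsDownSet : Subset size → Set
  IsDownSet A = ∀ {x y} → x ≤ y → y ∈ A → x ∈ A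

  ↓ : Carrier → Subset size
  ↓ x = comprehension (_≤? x)

  ↓-isDownSet : ∀ x → IsDownSet (↓ x)
  ↓-isDownSet x u≤v v∈ =
    ∈-comprehension⁺ (_≤? x) (≤-trans u≤v (∈-comprehension⁻ (_≤? x) v∈))

  IsMaximalIn : Subset size → Carrier → Set
  IsMaximalIn A x = x ∈ A × (∀ y → y ∈ A → x ≤ y → x ≡ y)

  isMaximalIn? : ∀ A → Decidable (IsMaximalIn A)
  isMaximalIn? A x =
    (x ∈? A) ×-dec all? (λ y → (y ∈? A) →-dec ((x ≤? y) →-dec (x ≟ y)))

  maximal-above : ∀ A {x} → x ∈ A → ∃ λ m → IsMaximalIn A m × x ≤ m
  maximal-above A {x} = go (po-noetherian isPartialOrder x)
    where
    open import Relation.Binary.Construct.NonStrictToStrict _≡_ _≤_ renaming (_<_ to _≺_)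
    above? : ∀ x → Dec (∃ λ y → y ∈ A × x ≺ y)
    above? x = any? (λ y → (y ∈? A) ×-dec <-decidable _≟_ _≤?_ x y)
    go : ∀ {x} → Acc (λ u v → v ≺ u) x → x ∈ A → ∃ λ m → IsMaximalIn A m × x ≤ m
    go {x} (acc rs) x∈A with above? x
    ... | yes (y , y∈A , x≺y) with go (rs x≺y) y∈A
    ...   | m , max , y≤m = m , max , ≤-trans (proj₁ x≺y) y≤m
    go {x} (acc rs) x∈A | no none = x , (x∈A , maximal) , ≤-refl
      where
      maximal : ∀ y → y ∈ A → x ≤ y → x ≡ y
      maximal y y∈A x≤y with x ≟ y
      ... | yes x≡y = x≡y
      ... | no  x≢y = contradiction (y , y∈A , x≤y , x≢y) none

module _ (Q R : FinPoset) (p : FinPoset.Carrier Q → FinPoset.Carrier R) where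
  private
    module Q = FinPoset Q
    module R = FinPoset R

  -- p̂(A) = ⋃ ↓ p(x) over the maximal elements x of A; for A = ∅ this is ∅.

  InHat : Subset Q.size → Pred R.Carrier 0ℓ
  InHat A b = ∃ λ x → IsMaximalIn Q A x × b R.≤ p x

  inHat? : ∀ A → Decidable (InHat A)
  inHat? A b = any? (λ x → isMaximalIn? Q A x ×-dec (b R.≤? p x))

  hat : Subset Q.size → Subset R.size
  hat A = comprehension (inHat? A)

  module _ (isQuotient : IsFinQuotientMap Q R p) where
    open IsQuotientMap isQuotient
    open IsOrderHomomorphism isOrderHomomorphism using (mono)

    ∈-hat⁺ : ∀ A {b x} → x ∈ A → b R.≤ p x → b ∈ hat A
    ∈-hat⁺ A x∈A b≤px with maximal-above Q A x∈A
    ... | m , max , x≤m =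
      ∈-comprehension⁺ (inHat? A) (m , max , R.≤-trans b≤px (mono x≤m))

    ∈-hat⁻ : ∀ A {b} → b ∈ hat A → ∃ λ x → x ∈ A × b R.≤ p x
    ∈-hat⁻ A b∈ with ∈-comprehension⁻ (inHat? A) b∈
    ... | x , (x∈A , _) , b≤px = x , x∈A , b≤px

    hat-∪ : ∀ A B → hat (A ∪ B) ≡ hat A ∪ hat B
    hat-∪ A B = ⊆-antisym to from
      where
      to : hat (A ∪ B) ⊆ hat A ∪ hat B
      to b∈ with ∈-hat⁻ (A ∪ B) b∈
      ... | x , x∈ , b≤px = x∈p∪q⁺
        (Sum.map (λ x∈A → ∈-hat⁺ A x∈A b≤px) (λ x∈B → ∈-hat⁺ B x∈B b≤px) (x∈p∪q⁻ A B x∈))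
      from : hat A ∪ hat B ⊆ hat (A ∪ B)
      from b∈ with x∈p∪q⁻ (hat A) (hat B) b∈
      ... | inj₁ b∈A = let (x , x∈ , b≤) = ∈-hat⁻ A b∈A in ∈-hat⁺ (A ∪ B) (x∈p∪q⁺ (inj₁ x∈)) b≤
      ... | inj₂ b∈B = let (x , x∈ , b≤) = ∈-hat⁻ B b∈B in ∈-hat⁺ (A ∪ B) (x∈p∪q⁺ (inj₂ x∈)) b≤

    hat-↓ : ∀ x → hat (↓ Q x) ≡ ↓ R (p x)
    hat-↓ x = ⊆-antisym to from
      where
      to : hat (↓ Q x) ⊆ ↓ R (p x)
      to b∈ with ∈-hat⁻ (↓ Q x) b∈
      ... | y , y∈ , b≤py =
        ∈-comprehension⁺ (R._≤? p x) (R.≤-trans b≤py (mono (∈-comprehension⁻ (Q._≤? x) y∈)))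
      from : ↓ R (p x) ⊆ hat (↓ Q x)
      from b∈ = ∈-hat⁺ (↓ Q x) (∈-comprehension⁺ (Q._≤? x) Q.≤-refl)
                       (∈-comprehension⁻ (R._≤? p x) b∈)

record InverseSequence : Set₁ where
  field
    P            : ℕ → FinPoset
    bond         : ∀ {k m} → k < m → FinPoset.Carrier (P m) → FinPoset.Carrier (P k)
    bondQuotient : ∀ {k m} (k<m : k < m) → IsFinQuotientMap (P m) (P k) (bond k<m)
    bond-∘       : ∀ {l k m} (l<k : l < k) (k<m : k < m) x →
                   bond l<k (bond k<m x) ≡ bond (<-trans l<k k<m) x

  ∣P∣ : ℕ → Set
  ∣P∣ n = FinPoset.Carrier (P n)

  step : ∀ n → ∣P∣ (suc n) → ∣P∣ n
  step n = bond (n<1+n n)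

  stepHat : ∀ n → Subset (FinPoset.size (P (suc n))) → Subset (FinPoset.size (P n))
  stepHat n = hat (P (suc n)) (P n) (step n)

record IsFraisse (S : InverseSequence) : Set₁ where
  open InverseSequence S
  field
    universal    : ∀ X → ∃₂ λ n g → IsFinQuotientMap (P n) X g
    amalgamation : ∀ k Y (f : FinPoset.Carrier Y → ∣P∣ k) → IsFinQuotientMap Y (P k) f →
                   ∃ λ ℓ → Σ (k < ℓ) λ k<ℓ → ∃ λ g →
                   IsFinQuotientMap (P ℓ) Y g × (∀ x → f (g x) ≡ bond k<ℓ x)

record Lim (S : InverseSequence) : Set where
  constructor mkLim
  open InverseSequence S
  field
    coord  : ∀ n → ∣P∣ n
    thread : ∀ n → step n (coord (suc n)) ≡ coord n

limPoset : InverseSequence → Poset 0ℓ 0ℓ 0ℓ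
limPoset S = record
  { Carrier = Lim S
  ; _≈_ = λ x y → ∀ n → coord x n ≡ coord y n
  ; _≤_ = λ x y → ∀ n → FinPoset._≤_ (P n) (coord x n) (coord y n)
  ; isPartialOrder = record
    { isPreorder = record
      { isEquivalence = record
        { refl  = λ _ → refl
        ; sym   = λ e n → sym (e n)
        ; trans = λ e e′ n → trans (e n) (e′ n)
        }
      ; reflexive = λ e n → FinPoset.≤-reflexive (P n) (e n)
      ; trans     = λ r s n → FinPoset.≤-trans (P n) (r n) (s n)
      }
    ; antisym = λ r s n → FinPoset.≤-antisym (P n) (r n) (s n)
    }
  }
  where
  open InverseSequence S
  open Lim

record 𝕆 (S : InverseSequence) : Set where
  constructor mk𝕆
  open InverseSequence S
  field
    coord     : ∀ n → Subset (FinPoset.size (P n))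
    isDownSet : ∀ n → IsDownSet (P n) (coord n)
    thread    : ∀ n → stepHat n (coord (suc n)) ≡ coord n

module _ (S : InverseSequence) where
  open InverseSequence S
  open 𝕆
  open ≡-Reasoning

  𝕆-join : 𝕆 S → 𝕆 S → 𝕆 S
  𝕆-join A B = mk𝕆 (λ n → coord A n ∪ coord B n) down thread∪
    where
    down : ∀ n → IsDownSet (P n) (coord A n ∪ coord B n)
    down n x≤y y∈ = x∈p∪q⁺
      (Sum.map (isDownSet A n x≤y) (isDownSet B n x≤y) (x∈p∪q⁻ (coord A n) (coord B n) y∈))
    thread∪ : ∀ n → stepHat n (coord A (suc n) ∪ coord B (suc n)) ≡ coord A n ∪ coord B n
    thread∪ n = begin
      stepHat n (coord A (suc n) ∪ coord B (suc n))
        ≡⟨ hat-∪ (P (suc n)) (P n) (step n) (bondQuotient (n<1+n n)) _ _ ⟩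
      stepHat n (coord A (suc n)) ∪ stepHat n (coord B (suc n))
        ≡⟨ cong (_∪ _) (thread A n) ⟩
      coord A n ∪ stepHat n (coord B (suc n))
        ≡⟨ cong (coord A n ∪_) (thread B n) ⟩
      coord A n ∪ coord B n ∎

  𝕆-joinSemilattice : JoinSemilattice 0ℓ 0ℓ 0ℓ
  𝕆-joinSemilattice = record
    { Carrier = 𝕆 S
    ; _≈_ = λ A B → ∀ n → coord A n ≡ coord B n
    ; _≤_ = λ A B → ∀ n → coord A n ⊆ coord B n
    ; _∨_ = 𝕆-join
    ; isJoinSemilattice = record
      { isPartialOrder = record
        { isPreorder = record
          { isEquivalence = record
            { refl  = λ _ → refl
            ; sym   = λ e n → sym (e n)
            ; trans = λ e e′ n → trans (e n) (e′ n)
            }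
          ; reflexive = λ e n → ⊆-reflexive (e n)
          ; trans     = λ r s n → ⊆-trans (r n) (s n)
          }
        ; antisym = λ r s n → ⊆-antisym (r n) (s n)
        }
      ; supremum = λ A B →
          (λ n → p⊆p∪q (coord B n)) ,
          (λ n → q⊆p∪q (coord A n) (coord B n)) ,
          (λ C r s n x∈ → [ r n , s n ]′ (x∈p∪q⁻ (coord A n) (coord B n) x∈))
      }
    }

  𝕆-poset : Poset 0ℓ 0ℓ 0ℓ
  𝕆-poset = JoinSemilattice.poset 𝕆-joinSemilattice

  principal : Lim S → 𝕆 S
  principal x = mk𝕆 (λ n → ↓ (P n) (Lim.coord x n))
    (λ n → ↓-isDownSet (P n) (Lim.coord x n))
    (λ n → trans (hat-↓ (P (suc n)) (P n) (step n) (bondQuotient (n<1+n n)) _)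
                 (cong (↓ (P n)) (Lim.thread x n)))

Opens : Set a → (ℓ : Level) → Set (a ⊔ lsuc (0ℓ ⊔ ℓ))
Opens A ℓ = Pred (Pred A 0ℓ) ℓ

-- The product of the discrete spaces X n: the basic neighbourhoods of x are
-- the cylinders fixing finitely many, hence without loss of generality an
-- initial segment of, coordinates of x.

productOpens : (X : ℕ → Set) → Opens (∀ n → X n) 0ℓ
productOpens X V =
  ∀ x → V x → ∃ λ N → ∀ y → (∀ n → n < N → y n ≡ x n) → V y

subspaceOpens : {A B : Set} → (A → B) → Opens B ℓ → Opens A (lsuc 0ℓ ⊔ ℓ)
subspaceOpens ι τ U = ∃ λ V → τ V × U ≐ (ι ⊢ V)

Continuous : {A B : Set} → Opens A ℓ → Opens B ℓ → (A → B) → Set (lsuc 0ℓ ⊔ ℓ)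
Continuous τ σ f = ∀ U → σ U → τ (f ⊢ U)

limOpens : ∀ S → Opens (Lim S) (lsuc 0ℓ)
limOpens S = subspaceOpens Lim.coord (productOpens (InverseSequence.∣P∣ S))

-- The discrete space of down-sets of P n is a subspace of the discrete space
-- of all subsets of P n, so coordinates may be compared as subsets.

𝕆Opens : ∀ S → Opens (𝕆 S) (lsuc 0ℓ)
𝕆Opens S = subspaceOpens 𝕆.coord
  (productOpens (λ n → Subset (FinPoset.size (InverseSequence.P S n))))

{-# OPTIONS --safe #-}

-- An element A of 𝕆(S) is determined by its points, the x ∈ lim S with xₙ ∈ Aₙ
-- for all n: a maximal element of Aₙ lifts to a maximal element of Aₙ₊₁, so
-- every element of Aₙ lies below the n-th coordinate of a point of A.  The map q
-- sends A to the down-set generated by the f-images of the points of A.  By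
-- compactness there is, for every n, an m such that xₘ ≤ yₘ implies
-- f(x)ₙ ≤ f(y)ₙ; hence q is continuous and preserves joins, and the down-set
-- generated by f⁻¹(C) is a preimage of C under q, monotone in C.

module Submission where

open import Defs
open import Algebra.Morphism.Definitions using (Homomorphic₂)
open import Axiom.ExcludedMiddle using (ExcludedMiddle)
open import Data.Fin using (Fin; zero; suc)
open import Data.Fin.Subset using (_∈_; _⊆_; _∪_)
open import Data.Fin.Subset.Properties using (⊆-antisym; x∈p∪q⁺; x∈p∪q⁻)
open import Data.Nat using (ℕ; zero; suc; _≤_; _<_; _⊔_; s≤s; _≤′_; ≤′-refl; ≤′-step)
open import Data.Nat.Properties
  using (≤⇒≤′; <⇒≤; n<1+n; m≤m⊔n; m≤n⊔m)
open import Data.Product using (Σ; ∃; _×_; _,_; proj₁; proj₂)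
open import Data.Sum as Sum using (inj₁; inj₂; [_,_]′)
open import Function using (_∘_)
open import Level using (0ℓ)
open import Relation.Binary.Bundles using (Poset)
open import Relation.Binary.Morphism.Structures using (IsOrderHomomorphism)
open import Relation.Binary.PropositionalEquality using (_≡_; refl; sym; trans; subst)
open import Relation.Nullary using (¬_; yes; no; contradiction)
open import Relation.Nullary.Decidable using (decidable-stable)

-- Uniform bounds over finite families, and threads of inverse sequences

UpwardClosed : (ℕ → Set) → Set
UpwardClosed T = ∀ {m n} → m ≤ n → T m → T n

uniform-Fin : ∀ {k} (T : Fin k → ℕ → Set) → (∀ i → UpwardClosed (T i)) →
              (∀ i → ∃ (T i)) → ∃ λ m → ∀ i → T i m
uniform-Fin {zero}  T up some = 0 , λ ()
uniform-Fin {suc k} T up some =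
  let (m , t)  = some zero
      (n , ts) = uniform-Fin (T ∘ suc) (up ∘ suc) (some ∘ suc)
  in m ⊔ n , λ { zero    → up zero (m≤m⊔n m n) t
               ; (suc i) → up (suc i) (m≤n⊔m m n) (ts i) }

uniform-< : (T : ℕ → ℕ → Set) → (∀ i → UpwardClosed (T i)) →
            (∀ i → ∃ (T i)) → ∀ N → ∃ λ m → ∀ i → i < N → T i m
uniform-< T up some zero    = 0 , λ _ ()
uniform-< T up some (suc N) =
  let (m , t)  = some zero
      (n , ts) = uniform-< (T ∘ suc) (up ∘ suc) (some ∘ suc) N
  in m ⊔ n , λ { zero    _         → up zero (m≤m⊔n m n) t
               ; (suc i) (s≤s i<N) → up (suc i) (m≤n⊔m m n) (ts i i<N) }

Threads : (F : ℕ → Set) → (∀ n → F (suc n) → F n) → Set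
Threads F π = Σ (∀ n → F n) λ x → ∀ n → π n (x (suc n)) ≡ x n

thread-from-0 : {F : ℕ → Set} (π : ∀ n → F (suc n) → F n) (Q : ∀ n → F n → Set) →
                (∀ n a → Q n a → ∃ λ b → Q (suc n) b × π n b ≡ a) →
                ∀ a → Q 0 a →
                Σ (Threads F π) λ (x , _) → x 0 ≡ a × (∀ n → Q n (x n))
thread-from-0 {F} π Q extend a q =
  ((λ n → proj₁ (build n)) , λ n → let (_ , q) = build n in proj₂ (proj₂ (extend n _ q))) ,
  refl , λ n → proj₂ (build n)
  where
  build : ∀ n → Σ (F n) (Q n)
  build zero    = a , q
  build (suc n) = let (b , q)      = build n
                      (c , q′ , _) = extend n b q
                  in c , q′

-- Q need not be closed under π (maximality is not), so only the weaker R is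
-- claimed of the coordinates below the starting one.
thread-through : {F : ℕ → Set} (π : ∀ n → F (suc n) → F n) (Q R : ∀ n → F n → Set) →
                 (∀ n a → Q n a → ∃ λ b → Q (suc n) b × π n b ≡ a) →
                 (∀ n a → Q n a → R n a) →
                 (∀ n a → R (suc n) a → R n (π n a)) →
                 ∀ m a → Q m a →
                 Σ (Threads F π) λ (x , _) → x m ≡ a × (∀ n → R n (x n))
thread-through π Q R extend Q⊆R descend zero a q =
  let (x , x₀≡a , qs) = thread-from-0 π Q extend a q
  in x , x₀≡a , λ n → Q⊆R n _ (qs n)
thread-through π Q R extend Q⊆R descend (suc m) a q =
  -- Dropping level 0 turns level `suc m` into level `m`; the missing coordinate is then forced to
  -- be the image under `π 0`.
  let ((x , thread) , xₘ≡a , rs) =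
        thread-through (π ∘ suc) (Q ∘ suc) (R ∘ suc)
          (extend ∘ suc) (Q⊆R ∘ suc) (descend ∘ suc) m a q
  in ( (λ { zero → π 0 (x 0) ; (suc n) → x n })
     , (λ { zero → refl ; (suc n) → thread n }) )
     , xₘ≡a
     , (λ { zero → descend 0 _ (rs 0) ; (suc n) → rs n })

-- Compactness of the limit

module _ (S : InverseSequence) where
  open InverseSequence S
  open Lim
  private module ℙ n = FinPoset (P n)

  coord-≤-descend : ∀ (x y : Lim S) → ∀ {m n} → m ≤ n →
                    ℙ._≤_ n (coord x n) (coord y n) → ℙ._≤_ m (coord x m) (coord y m)
  coord-≤-descend x y = go ∘ ≤⇒≤′
    where
    go : ∀ {m n} → m ≤′ n →
         ℙ._≤_ n (coord x n) (coord y n) → ℙ._≤_ m (coord x m) (coord y m)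
    go ≤′-refl x≤y = x≤y
    go {m} (≤′-step {n} m≤n) x≤y = go m≤n
      (subst (λ a → ℙ._≤_ n a (coord y n)) (thread x n)
        (subst (ℙ._≤_ n _) (thread y n)
          (IsOrderHomomorphism.mono
            (IsQuotientMap.isOrderHomomorphism (bondQuotient (n<1+n n))) x≤y)))

  coord-≡-descend : ∀ (x y : Lim S) → ∀ {m n} → m ≤ n →
                    coord x n ≡ coord y n → coord x m ≡ coord y m
  coord-≡-descend x y {m} {n} m≤n x≡y = ℙ.≤-antisym m
    (coord-≤-descend x y m≤n (ℙ.≤-reflexive n x≡y))
    (coord-≤-descend y x m≤n (ℙ.≤-reflexive n (sym x≡y)))

  -- If no m works, then Kőnig's lemma gives a point x such that no m works on
  -- the cylinder of any coordinate of x.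
  compact : ExcludedMiddle 0ℓ → (T : Lim S → ℕ → Set) → (∀ x → UpwardClosed (T x)) →
            (∀ x → ∃ λ m → ∀ y → coord y m ≡ coord x m → T y m) →
            ∃ λ m → ∀ x → T x m
  compact lem T up local =
    let (m , t) = uniform-Fin (GoodAt 0) (λ a m≤n t y e → up y m≤n (t y e)) good₀
    in m , λ x → t _ x refl
    where
    GoodAt : ∀ k → ∣P∣ k → ℕ → Set
    GoodAt k a m = ∀ y → coord y k ≡ a → T y m

    Bad : ∀ k → ∣P∣ k → Set
    Bad k a = ¬ ∃ (GoodAt k a)

    extend : ∀ k a → Bad k a → ∃ λ b → Bad (suc k) b × step k b ≡ a
    extend k a bad with lem {∃ λ b → Bad (suc k) b × step k b ≡ a}
    ... | yes child   = child
    ... | no  noChild = contradiction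
      -- With no bad child, the finitely many children have a common bound, which serves for `a`
      -- because every point through `a` passes through a child.
      (let (m , t) = uniform-Fin (λ b m → step k b ≡ a → GoodAt (suc k) b m)
                       (λ b m≤n t e y e′ → up y m≤n (t e y e′)) good
       in m , λ y e → t _ (trans (thread y k) e) y refl)
      bad
      where
      good : ∀ b → ∃ λ m → step k b ≡ a → GoodAt (suc k) b m
      good b with lem {step k b ≡ a}
      -- Off the fibre over `a` the condition is vacuous, so any bound serves.
      ... | no  e≢ = 0 , λ e → contradiction e e≢
      ... | yes e  =
        let (m , t) = decidable-stable lem (λ bad′ → noChild (b , bad′ , e))
        in m , λ _ → t

    good₀ : ∀ a → ∃ (GoodAt 0 a)
    good₀ a = decidable-stable lem λ bad →
      let ((x , thread) , _ , bads) = thread-from-0 step Bad extend a bad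
          (m , t)                   = local (mkLim {S = S} x thread)
      in bads m (m , t)

  -- Points and generation of elements of `𝕆 S`

  infix 4 _∈ᴾ_
  _∈ᴾ_ : Lim S → 𝕆 S → Set
  x ∈ᴾ A = ∀ n → coord x n ∈ 𝕆.coord A n

  -- Passes from a membership at one level to a point of the limit, to which a map on `Lim S` can be
  -- applied.
  point-above : ∀ A n {a} → a ∈ 𝕆.coord A n →
                ∃ λ x → x ∈ᴾ A × ℙ._≤_ n a (coord x n)
  point-above A n {a} a∈A =
    let (m , max , a≤m)            = maximal-above (P n) (𝕆.coord A n) a∈A
        ((x , thread) , xₙ≡m , ∈A) =
          thread-through step (λ k → IsMaximalIn (P k) (𝕆.coord A k)) (λ k → _∈ 𝕆.coord A k)
            extend (λ _ _ → proj₁) descend n m max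
    in mkLim {S = S} x thread , ∈A , subst (ℙ._≤_ n a) (sym xₙ≡m) a≤m
    where
    descend : ∀ k b → b ∈ 𝕆.coord A (suc k) → step k b ∈ 𝕆.coord A k
    descend k b b∈A = subst (step k b ∈_) (𝕆.thread A k)
      (∈-hat⁺ (P (suc k)) (P k) (step k) (bondQuotient (n<1+n k)) _ b∈A (ℙ.≤-refl k))

    -- The thread condition puts `b` below `step k c` for a maximal `c`; as `step k c` lies in `A`
    -- again, maximality of `b` forces equality.
    extend : ∀ k b → IsMaximalIn (P k) (𝕆.coord A k) b →
             ∃ λ c → IsMaximalIn (P (suc k)) (𝕆.coord A (suc k)) c × step k c ≡ b
    extend k b (b∈A , max)
      with ∈-comprehension⁻ (inHat? (P (suc k)) (P k) (step k) (𝕆.coord A (suc k)))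
             (subst (b ∈_) (sym (𝕆.thread A k)) b∈A)
    ... | c , cMax , b≤ = c , cMax , sym (max _ (descend k c (proj₁ cMax)) b≤)

  module _ (lem : ExcludedMiddle 0ℓ) where

    -- The supremum of the elements `principal S (x i)`, a union at each level. Excluded middle
    -- decides membership, since `I` may be infinite.
    generate : {I : Set} → (I → Lim S) → 𝕆 S
    generate {I} x = mk𝕆 (λ n → comprehension (below? n)) down threads
      where
      Below : ∀ n → ∣P∣ n → Set
      Below n b = ∃ λ i → ℙ._≤_ n b (coord (x i) n)
      below? : ∀ n b → _
      below? n b = lem {Below n b}
      down : ∀ n → IsDownSet (P n) (comprehension (below? n))
      down n a≤b b∈ =
        let (i , b≤) = ∈-comprehension⁻ (below? n) b∈
        in ∈-comprehension⁺ (below? n) (i , ℙ.≤-trans n a≤b b≤)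
      threads : ∀ n → stepHat n (comprehension (below? (suc n))) ≡ comprehension (below? n)
      threads n = ⊆-antisym to from
        where
        isQuotient = bondQuotient (n<1+n n)
        to : stepHat n (comprehension (below? (suc n))) ⊆ comprehension (below? n)
        to b∈ =
          let (c , c∈ , b≤) = ∈-hat⁻ (P (suc n)) (P n) (step n) isQuotient _ b∈
              (i , c≤)      = ∈-comprehension⁻ (below? (suc n)) c∈
              mono          = IsOrderHomomorphism.mono
                                (IsQuotientMap.isOrderHomomorphism isQuotient)
          in ∈-comprehension⁺ (below? n)
               (i , ℙ.≤-trans n b≤ (subst (ℙ._≤_ n _) (thread (x i) n) (mono c≤)))
        from : comprehension (below? n) ⊆ stepHat n (comprehension (below? (suc n)))
        from b∈ =
          let (i , b≤) = ∈-comprehension⁻ (below? n) b∈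
          in ∈-hat⁺ (P (suc n)) (P n) (step n) isQuotient _
               (∈-comprehension⁺ (below? (suc n)) (i , ℙ.≤-refl (suc n)))
               (subst (ℙ._≤_ n _) (sym (thread (x i) n)) b≤)

    module _ {I : Set} (x : I → Lim S) {n : ℕ} {b : ∣P∣ n} where

      ∈-generate⁺ : ∀ i → ℙ._≤_ n b (coord (x i) n) → b ∈ 𝕆.coord (generate x) n
      ∈-generate⁺ i b≤ = ∈-comprehension⁺ (λ _ → lem) (i , b≤)

      ∈-generate⁻ : b ∈ 𝕆.coord (generate x) n → ∃ λ i → ℙ._≤_ n b (coord (x i) n)
      ∈-generate⁻ = ∈-comprehension⁻ (λ _ → lem)

-- Uniform continuity of `f` with respect to the order

module _ (lem : ExcludedMiddle 0ℓ) (S R : InverseSequence) (f : Lim S → Lim R)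
         (f-mono : ∀ {x y} → Poset._≤_ (limPoset S) x y → Poset._≤_ (limPoset R) (f x) (f y))
         (f-continuous : Continuous (limOpens S) (limOpens R) f) where
  private
    module S = InverseSequence S
    module R = InverseSequence R
    module SP n = FinPoset (S.P n)
    module RP n = FinPoset (R.P n)
  open Lim

  locally-constant : ∀ n x → ∃ λ m → ∀ y → coord y m ≡ coord x m →
                     coord (f y) n ≡ coord (f x) n
  locally-constant n x
    with f-continuous (λ z → coord z n ≡ coord (f x) n)
           ( (λ s → s n ≡ coord (f x) n)
           -- A cylinder fixes the indices strictly below its bound, so reaching index `n` takes
           -- `suc n`.
           , (λ s e → suc n , λ t agree → trans (agree n (n<1+n n)) e)
           , (λ e → e) , (λ e → e) )
  ... | V , V-open , to , from with V-open (coord x) (to refl)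
  -- Agreement at level `m` forces agreement at all lower levels, hence membership in the cylinder.
  ...   | m , agree⇒V = m , λ y e →
    from (agree⇒V (coord y) (λ i i<m → coord-≡-descend S y x (<⇒≤ i<m) e))

  -- An order version of a modulus of uniform continuity; used in both directions it also transfers
  -- equality of coordinates.
  Modulus : ℕ → ℕ → Set
  Modulus n m = ∀ x y → SP._≤_ m (coord x m) (coord y m) →
                RP._≤_ n (coord (f x) n) (coord (f y) n)

  modulus-upward : ∀ n → UpwardClosed (Modulus n)
  modulus-upward n m≤k mod x y x≤y = mod x y (coord-≤-descend S x y m≤k x≤y)

  -- The condition concerns pairs, so compactness is applied twice: in `y` for a fixed `x`, then in
  -- `x`.
  modulus : ∀ n → ∃ (Modulus n)
  modulus n = compact S lem
    (λ x m → ∀ y → T x y m)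
    (λ x m≤k t y x≤y → t y (coord-≤-descend S x y m≤k x≤y))
    near
    where
    T : Lim S → Lim S → ℕ → Set
    T x y m = SP._≤_ m (coord x m) (coord y m) → RP._≤_ n (coord (f x) n) (coord (f y) n)

    -- Either `x ≤ y` fails at a finite level, and the premise fails for all `z` agreeing with `y`
    -- there, or `f x ≤ f y` and coordinate `n` of `f` is constant near `y`.
    nearᵣ : ∀ x y → ∃ λ m → ∀ z → coord z m ≡ coord y m → T x z m
    nearᵣ x y with lem {∃ λ m → ¬ SP._≤_ m (coord x m) (coord y m)}
    ... | yes (m , x≰y) = m , λ z e x≤z →
      contradiction (subst (SP._≤_ m (coord x m)) e x≤z) x≰y
    ... | no  x≰y→⊥ =
      let (m , const) = locally-constant n y
          x≤y i       = decidable-stable (SP._≤?_ i _ _) (λ x≰y → x≰y→⊥ (i , x≰y))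
      in m , λ z e _ → subst (RP._≤_ n _) (sym (const z e)) (f-mono {x} {y} x≤y n)

    near : ∀ x → ∃ λ m → ∀ z → coord z m ≡ coord x m → ∀ y → T z y m
    near x =
      let (k , t)     = compact S lem (T x)
                          (λ y m≤k t x≤y → t (coord-≤-descend S x y m≤k x≤y)) (nearᵣ x)
          (m , const) = locally-constant n x
          k≤          = m≤n⊔m m k
      -- Agreement with `x` at level `k` carries the premise from `z` to `x`; agreement at level `m`
      -- carries the conclusion back.
      in m ⊔ k , λ z e y z≤y →
        subst (λ a → RP._≤_ n a (coord (f y) n))
          (sym (const z (coord-≡-descend S z x (m≤m⊔n m k) e)))
          (t y (subst (λ a → SP._≤_ k a (coord y k)) (coord-≡-descend S z x k≤ e)
                 (coord-≤-descend S z y k≤ z≤y)))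

  -- The induced map on `𝕆`: continuity, joins and principal elements

  Points : 𝕆 S → Set
  Points A = Σ (Lim S) λ x → _∈ᴾ_ S x A

  image : 𝕆 S → 𝕆 R
  image A = generate R lem {Points A} (f ∘ proj₁)

  preimage : 𝕆 R → 𝕆 S
  preimage C = generate S lem {Σ (Lim S) λ x → _∈ᴾ_ R (f x) C} proj₁

  ∈-image⁺ : ∀ A {n b} x → _∈ᴾ_ S x A → RP._≤_ n b (coord (f x) n) → b ∈ 𝕆.coord (image A) n
  ∈-image⁺ A x x∈A = ∈-generate⁺ R lem {Points A} (f ∘ proj₁) (x , x∈A)

  ∈-image⁻ : ∀ A {n b} → b ∈ 𝕆.coord (image A) n →
             ∃ λ x → _∈ᴾ_ S x A × RP._≤_ n b (coord (f x) n)
  ∈-image⁻ A b∈ =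
    let ((x , x∈A) , b≤) = ∈-generate⁻ R lem {Points A} (f ∘ proj₁) b∈ in x , x∈A , b≤

  -- Here `x` need not be a point of `A`: some point `y` of `A` lies above it at level `m`, and the
  -- modulus compares `f x` with `f y` at level `n`.
  ∈-image-modulus⁺ : ∀ A {n m b} → Modulus n m → ∀ x → coord x m ∈ 𝕆.coord A m →
                     RP._≤_ n b (coord (f x) n) → b ∈ 𝕆.coord (image A) n
  ∈-image-modulus⁺ A {n} {m} mod x xₘ∈A b≤ =
    let (y , y∈A , x≤y) = point-above S A m xₘ∈A
    in ∈-image⁺ A y y∈A (RP.≤-trans n b≤ (mod x y x≤y))

  image-modulus-⊆ : ∀ A B {n m} → Modulus n m → 𝕆.coord A m ⊆ 𝕆.coord B m →
                    𝕆.coord (image A) n ⊆ 𝕆.coord (image B) n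
  image-modulus-⊆ A B {m = m} mod A⊆B b∈ =
    let (x , x∈A , b≤) = ∈-image⁻ A b∈
    in ∈-image-modulus⁺ B mod x (A⊆B (x∈A m)) b≤

  image-modulus-≡ : ∀ A B {n m} → Modulus n m → 𝕆.coord A m ≡ 𝕆.coord B m →
                    𝕆.coord (image A) n ≡ 𝕆.coord (image B) n
  image-modulus-≡ A B mod A≡B = ⊆-antisym
    (image-modulus-⊆ A B mod (λ {a} → subst (a ∈_) A≡B))
    (image-modulus-⊆ B A mod (λ {a} → subst (a ∈_) (sym A≡B)))

  image-mono : ∀ {A B} → Poset._≤_ (𝕆-poset S) A B → Poset._≤_ (𝕆-poset R) (image A) (image B)
  image-mono {A} {B} A≤B n = image-modulus-⊆ A B (proj₂ (modulus n)) (A≤B _)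

  image-cong : ∀ {A B} → Poset._≈_ (𝕆-poset S) A B → Poset._≈_ (𝕆-poset R) (image A) (image B)
  image-cong {A} {B} A≈B n = image-modulus-≡ A B (proj₂ (modulus n)) (A≈B _)

  image-continuous : Continuous (𝕆Opens S) (𝕆Opens R) image
  image-continuous U (V , V-open , U⊆V , V⊆U) = W , W-open , (λ {A} → to {A}) , (λ {A} → from {A})
    where
    W : (∀ n → _) → Set
    -- The open set must live on all sequences of subsets, while `image` is defined on `𝕆 S` only;
    -- so `W` asks that some cylinder around `s` meets `𝕆 S` inside the preimage of `U`.
    W s = ∃ λ N → ∀ A → (∀ n → n < N → 𝕆.coord A n ≡ s n) → U (image A)

    W-open : productOpens _ W
    W-open s (N , inU) = N , λ t t≡s → N , λ A A≡t →
      inU A (λ n n<N → trans (A≡t n n<N) (t≡s n n<N))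

    to : ∀ {A} → U (image A) → W (𝕆.coord A)
    to {A} u =
      let (N , agree⇒V) = V-open (𝕆.coord (image A)) (U⊆V u)
          (m , mod)     = uniform-< Modulus modulus-upward modulus N
      -- The single level `m` controls all levels below `N`, and `suc m` makes the cylinder include
      -- it.
      in suc m , λ B B≡A → V⊆U (agree⇒V (𝕆.coord (image B)) λ n n<N →
           image-modulus-≡ B A (mod n n<N) (B≡A m (n<1+n m)))

    from : ∀ {A} → W (𝕆.coord A) → U (image A)
    from {A} (_ , inU) = inU A (λ _ _ → refl)

  image-∨ : Homomorphic₂ (𝕆 S) (𝕆 R) (Poset._≈_ (𝕆-poset R)) image (𝕆-join S) (𝕆-join R)
  image-∨ A B n = ⊆-antisym to from
    where
    mod = proj₂ (modulus n)
    to : 𝕆.coord (image (𝕆-join S A B)) n ⊆ 𝕆.coord (image A) n ∪ 𝕆.coord (image B) n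
    to b∈ =
      let (x , x∈ , b≤) = ∈-image⁻ (𝕆-join S A B) b∈
      -- A case split at the level of the modulus is enough; whether `x` is a point of `A` or of `B`
      -- is never decided.
      in x∈p∪q⁺ (Sum.map (λ x∈A → ∈-image-modulus⁺ A mod x x∈A b≤)
                         (λ x∈B → ∈-image-modulus⁺ B mod x x∈B b≤)
                         (x∈p∪q⁻ _ _ (x∈ _)))
    from : 𝕆.coord (image A) n ∪ 𝕆.coord (image B) n ⊆ 𝕆.coord (image (𝕆-join S A B)) n
    from b∈ = [ image-modulus-⊆ A (𝕆-join S A B) mod (x∈p∪q⁺ ∘ inj₁)
              , image-modulus-⊆ B (𝕆-join S A B) mod (x∈p∪q⁺ ∘ inj₂)
              ]′ (x∈p∪q⁻ _ _ b∈)

  image-principal : ∀ x → Poset._≈_ (𝕆-poset R) (image (principal S x)) (principal R (f x))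
  image-principal x n = ⊆-antisym to from
    where
    to : 𝕆.coord (image (principal S x)) n ⊆ ↓ (R.P n) (coord (f x) n)
    to b∈ =
      let (y , y∈ , b≤) = ∈-image⁻ (principal S x) b∈
          y≤x i         = ∈-comprehension⁻ (λ a → SP._≤?_ i a (coord x i)) (y∈ i)
      in ∈-comprehension⁺ (λ a → RP._≤?_ n a _) (RP.≤-trans n b≤ (f-mono {y} {x} y≤x n))
    from : ↓ (R.P n) (coord (f x) n) ⊆ 𝕆.coord (image (principal S x)) n
    from b∈ = ∈-image⁺ (principal S x) x
      (λ i → ∈-comprehension⁺ (λ a → SP._≤?_ i a (coord x i)) (SP.≤-refl i))
      (∈-comprehension⁻ (λ a → RP._≤?_ n a _) b∈)

  -- A monotone section, and the quotient property

  preimage-mono : ∀ {C D} → Poset._≤_ (𝕆-poset R) C D →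
                  Poset._≤_ (𝕆-poset S) (preimage C) (preimage D)
  preimage-mono C≤D n b∈ =
    let ((x , fx∈C) , b≤) = ∈-generate⁻ S lem proj₁ b∈
    in ∈-generate⁺ S lem proj₁ (x , λ i → C≤D i (fx∈C i)) b≤

  module _ (f-onto : ∀ z → ∃ λ x → Poset._≈_ (limPoset R) (f x) z) where

    image-preimage : ∀ C → Poset._≈_ (𝕆-poset R) (image (preimage C)) C
    image-preimage C n = ⊆-antisym to from
      where
      to : 𝕆.coord (image (preimage C)) n ⊆ 𝕆.coord C n
      to b∈ =
        let (y , y∈ , b≤)        = ∈-image⁻ (preimage C) b∈
            (m , mod)            = modulus n
            -- The generator above `y` may vary with the level, so it is chosen at the level of the
            -- modulus for `n`.
            ((x , fx∈C) , yₘ≤xₘ) = ∈-generate⁻ S lem proj₁ (y∈ m)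
        in 𝕆.isDownSet C n (RP.≤-trans n b≤ (mod y x yₘ≤xₘ)) (fx∈C n)
      from : 𝕆.coord C n ⊆ 𝕆.coord (image (preimage C)) n
      from b∈ =
        -- Surjectivity of `f` concerns points, so `b` is first put below a point of `C`.
        let (z , z∈C , b≤) = point-above R C n b∈
            (x , fx≈z)     = f-onto z
            fx∈C i         = subst (_∈ 𝕆.coord C i) (sym (fx≈z i)) (z∈C i)
        in ∈-image⁺ (preimage C) x
             (λ i → ∈-generate⁺ S lem proj₁ (x , fx∈C) (SP.≤-refl i))
             (subst (RP._≤_ n _) (sym (fx≈z n)) b≤)

    image-isQuotientMap : IsQuotientMap (𝕆-poset S) (𝕆-poset R) image
    image-isQuotientMap = record
      { isOrderHomomorphism = record
        { cong = λ {A} {B} → image-cong {A} {B}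
        ; mono = λ {A} {B} → image-mono {A} {B}
        }
      ; surjective = λ C → preimage C , λ {A} A≈ n →
          trans (image-cong {A} {preimage C} A≈ n) (image-preimage C n)
      ; liftsOrder = λ {C} {D} C≤D →
          preimage C , preimage D , preimage-mono {C} {D} C≤D ,
          image-preimage C , image-preimage D
      }

mainTheorem17 : ExcludedMiddle 0ℓ →
    (H ℙ : InverseSequence) → IsFraisse ℙ →
    (f : Lim ℙ → Lim H) →
    IsQuotientMap (limPoset ℙ) (limPoset H) f →
    Continuous (limOpens ℙ) (limOpens H) f →
    ∃ λ (q : 𝕆 ℙ → 𝕆 H) →
    Continuous (𝕆Opens ℙ) (𝕆Opens H) q
    × Homomorphic₂ (𝕆 ℙ) (𝕆 H) (Poset._≈_ (𝕆-poset H)) q (𝕆-join ℙ) (𝕆-join H)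
    × IsQuotientMap (𝕆-poset ℙ) (𝕆-poset H) q
    × (∀ x → Poset._≈_ (𝕆-poset H) (q (principal ℙ x)) (principal H (f x)))
mainTheorem17 lem H ℙ _ f f-quotient f-continuous =
  image lem ℙ H f mono f-continuous ,
  image-continuous lem ℙ H f mono f-continuous ,
  image-∨ lem ℙ H f mono f-continuous ,
  image-isQuotientMap lem ℙ H f mono f-continuous onto ,
  image-principal lem ℙ H f mono f-continuous
  where
  open IsQuotientMap f-quotient
  mono : ∀ {x y} → Poset._≤_ (limPoset ℙ) x y → Poset._≤_ (limPoset H) (f x) (f y)
  mono {x} {y} = IsOrderHomomorphism.mono isOrderHomomorphism {x} {y}
  onto : ∀ z → ∃ λ x → Poset._≈_ (limPoset H) (f x) z
  onto z = let (x , fx≈z) = surjective z in x , fx≈z {x} (λ _ → refl)
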